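{- Let $r\ge 4$, $k\ge r-2$, and let $\mathbb{T}=\{L_1,\dots,L_r\}$ be an $r$-set of non-intersecting type such that $\left|\bigcup_{i=1}^r L_i\right|=\frac{r(k+1)}{2}$. Put $a_{i,j}=|L_i\cap L_j|$ for $1\le i<j\le r$. Then the tuple $(a_{i,j})_{1\le i<j\le r}$ corresponds one-to-one to the tuple $(a_{l,t})_{2\le l<t\le r}$ (that is, two such $r$-sets with the same tuple $(a_{l,t})_{2\le l<t\le r}$ have the same tuple $(a_{i,j})_{1\le i<j\le r}$), and the tuple $(a_{l,t})_{2\le l<t\le r}$ in turn corresponds to the decomposition into the sum of positive integers $$\frac{(r-2)(k+1)}{2}=\sum_{2\le l<t\le r}a_{l,t}.$$
   Context: Write $[m]=\{1,\dots,m\}$. A collection $\mathbb{T}=\{L_1,\dots,L_r\}$ of subsets $L_i\subset[n]$ with $|L_i|=k+1$ for all $i$ is called an $r$-set if $\bigcup_{i=1}^r L_i=\bigcup_{i\in I}L_i$ for every $I\subset[r]$ with $|I|=r-1$, and $L_i\cap L_j\ne\emptyset$ for all $1\le i<j\le r$. For $r\ge 4$, an $r$-set is of non-intersecting type if $L_i\cap L_j\cap L_m=\emptyset$ for all pairwise distinct $i,j,m\in[r]$. -}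

module Defs where

open import Data.Fin as Fin using (Fin; toℕ)
open import Data.Fin.Subset using (Subset; _∈_; _∩_; ⋃; ∣_∣; Nonempty; Empty)
open import Data.Fin.Subset.Properties using (_∈?_)
open import Data.List using (List; map; filter; allFin; tabulate; cartesianProduct)
open import Data.Nat using (ℕ; suc; _+_; _≤_; _≤?_)
open import Data.Nat.ListAction using (sum)
open import Data.Product using (_×_; _,_; uncurry)
open import Relation.Binary.PropositionalEquality using (_≡_; _≢_)
open import Relation.Nullary using (Dec)
open import Relation.Nullary.Decidable using (_×-dec_)

-- A collection {L₁, …, L_r} of subsets of [n] is an indexed family.  The
-- position i ∈ [r] is the element of Fin r whose toℕ is i - 1.

Family : ℕ → ℕ → Set
Family r n = Fin r → Subset n

module _ {r n : ℕ} (L : Family r n) where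

  union : Subset n
  union = ⋃ (tabulate L)

  unionOver : Subset r → Subset n
  unionOver I = ⋃ (map L (filter (_∈? I) (allFin r)))

  record IsRSet (k : ℕ) : Set where
    field
      size         : ∀ i → ∣ L i ∣ ≡ k + 1
      -- suc ∣ I ∣ ≡ r is |I| = r - 1 without truncated subtraction.
      redundant    : ∀ (I : Subset r) → suc ∣ I ∣ ≡ r → union ≡ unionOver I
      intersecting : ∀ i j → i Fin.< j → Nonempty (L i ∩ L j)

  NonIntersectingType : Set
  NonIntersectingType =
    ∀ i j m → i ≢ j → i ≢ m → j ≢ m → Empty (L i ∩ L j ∩ L m)

  a : Fin r → Fin r → ℕ
  a i j = ∣ L i ∩ L j ∣

-- Index pairs 2 ≤ l < t ≤ r; the suc converts to one-based positions.

Reduced : ∀ {r} → Fin r → Fin r → Set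
Reduced l t = 2 ≤ suc (toℕ l) × l Fin.< t

reduced? : ∀ {r} (l t : Fin r) → Dec (Reduced l t)
reduced? l t = (2 ≤? suc (toℕ l)) ×-dec (l Fin.<? t)

reducedPairs : ∀ r → List (Fin r × Fin r)
reducedPairs r = filter (λ (l , t) → reduced? l t) (cartesianProduct (allFin r) (allFin r))

reducedSum : ∀ {r} → (Fin r → Fin r → ℕ) → ℕ
reducedSum {r} f = sum (map (uncurry f) (reducedPairs r))

{-# OPTIONS --safe #-}
-- Irredundancy puts every point of ⋃ L in at least two of the sets, and the
-- non-intersecting type puts it in at most two.  Counting the points of L i by
-- the second set containing them gives ∑_{j ≠ i} a i j = k + 1.  Hence the
-- entries a 1 j are determined by the others, and summing the identity over
-- i ≥ 2 gives (r - 1)(k + 1) = (k + 1) + 2 ∑_{2 ≤ l < t} a l t.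
module Submission where

open import Data.Bool using (true; false; if_then_else_)
open import Data.Nat using (ℕ; zero; suc; _+_; _*_; _∸_; _≤_; s≤s; z≤n)
open import Data.Nat.ListAction using () renaming (sum to sumᴸ)
open import Data.Nat.ListAction.Properties using (sum-++)
open import Data.Nat.Properties using (+-0-commutativeMonoid; +-*-semiring; +-cancelˡ-≡; +-cancelʳ-≡; +-identityʳ)
open import Data.Nat.Solver using (module +-*-Solver)
open import Data.Fin using (Fin; zero; suc; _<_; _<?_; _≟_)
open import Data.Fin.Properties using (<-cmp)
open import Data.Fin.Subset using (Subset; ∣_∣; _∈_; _∉_; _∩_; ∁; ⁅_⁆; ⋃; Nonempty)
open import Data.Fin.Subset.Properties
open import Data.List using ([]; _∷_; _++_; map; filter; cartesianProduct; allFin; tabulate)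
open import Data.List.Properties using (map-++; map-∘; map-tabulate)
open import Data.List.Membership.Propositional using (find)
open import Data.List.Membership.Propositional.Properties using (∈-filter⁻)
open import Data.List.Relation.Unary.Any using (Any; here; there)
open import Data.List.Relation.Unary.Any.Properties using (map⁻; tabulate⁺)
open import Data.Product using (_×_; _,_; uncurry; ∃; proj₁; proj₂)
open import Data.Sum using (inj₁; inj₂)
open import Data.Vec using ([]; _∷_; lookup)
open import Data.Vec.Properties using ([]=⇒lookup; lookup⇒[]=)
open import Function using (_∘_)
open import Function.Bundles using (_⇔_; mk⇔)
open import Relation.Binary.Definitions using (tri<; tri≈; tri>)
open import Relation.Binary.PropositionalEquality using (_≡_; _≢_; refl; sym; trans; cong; cong₂; subst; module ≡-Reasoning)
open import Relation.Nullary using (yes; no; does; contradiction)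
open import Relation.Unary using (Pred; Decidable)
open import Defs

open import Algebra.Properties.CommutativeMonoid.Sum +-0-commutativeMonoid as ∑ using (sum; sum-syntax)
open import Algebra.Properties.Semiring.Sum +-*-semiring using (*-distribˡ-sum)
open +-*-Solver using (solve; _:+_; _:*_; _:=_; con)

-- Indicator functions, cardinalities and unions of subsets.

indicator : ∀ {n} → Subset n → Fin n → ℕ
indicator p x = if lookup p x then 1 else 0

indicator-∈ : ∀ {n} {p : Subset n} {x} → x ∈ p → indicator p x ≡ 1
indicator-∈ x∈p rewrite []=⇒lookup x∈p = refl

indicator-∉ : ∀ {n} {p : Subset n} {x} → x ∉ p → indicator p x ≡ 0
indicator-∉ {p = p} {x} x∉p with lookup p x in eq
... | true  = contradiction (lookup⇒[]= x p eq) x∉p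
... | false = refl

∣p∣≡∑indicator : ∀ {n} (p : Subset n) → ∣ p ∣ ≡ sum (indicator p)
∣p∣≡∑indicator []          = refl
∣p∣≡∑indicator (true  ∷ p) = cong suc (∣p∣≡∑indicator p)
∣p∣≡∑indicator (false ∷ p) = ∣p∣≡∑indicator p

nonempty⇒1≤∣p∣ : ∀ {n} {p : Subset n} → Nonempty p → 1 ≤ ∣ p ∣
nonempty⇒1≤∣p∣ {p = p} (x , x∈p) = subst (_≤ ∣ p ∣) (∣⁅x⁆∣≡1 x)
  (p⊆q⇒∣p∣≤∣q∣ λ y∈⁅x⁆ → subst (_∈ p) (sym (x∈⁅y⁆⇒x≡y x y∈⁅x⁆)) x∈p)

x∈⋃⁺ : ∀ {n} {x : Fin n} {ps} → Any (x ∈_) ps → x ∈ ⋃ ps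
x∈⋃⁺ (here x∈p)   = x∈p∪q⁺ (inj₁ x∈p)
x∈⋃⁺ (there x∈ps) = x∈p∪q⁺ (inj₂ (x∈⋃⁺ x∈ps))

x∈⋃⁻ : ∀ {n} {x : Fin n} ps → x ∈ ⋃ ps → Any (x ∈_) ps
x∈⋃⁻ []       x∈⊥ = contradiction x∈⊥ ∉⊥
x∈⋃⁻ (p ∷ ps) x∈∪ with x∈p∪q⁻ p (⋃ ps) x∈∪
... | inj₁ x∈p  = here x∈p
... | inj₂ x∈⋃ps = there (x∈⋃⁻ ps x∈⋃ps)

-- Sums over lists of pairs and double sums over `Fin`.

sum-map-filter : ∀ {A : Set} {p} {P : Pred A p} (P? : Decidable P) (f : A → ℕ) xs →
  sumᴸ (map f (filter P? xs)) ≡ sumᴸ (map (λ x → if does (P? x) then f x else 0) xs)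
sum-map-filter P? f []       = refl
sum-map-filter P? f (x ∷ xs) with does (P? x)
... | true  = cong (f x +_) (sum-map-filter P? f xs)
... | false = sum-map-filter P? f xs

sum-map-cartesianProduct : ∀ {A B : Set} (f : A × B → ℕ) xs ys →
  sumᴸ (map f (cartesianProduct xs ys)) ≡ sumᴸ (map (λ x → sumᴸ (map (λ y → f (x , y)) ys)) xs)
sum-map-cartesianProduct f []       ys = refl
sum-map-cartesianProduct f (x ∷ xs) ys = begin
  sumᴸ (map f (map (x ,_) ys ++ cartesianProduct xs ys))
    ≡⟨ cong sumᴸ (map-++ f (map (x ,_) ys) _) ⟩
  sumᴸ (map f (map (x ,_) ys) ++ map f (cartesianProduct xs ys))
    ≡⟨ sum-++ (map f (map (x ,_) ys)) _ ⟩
  sumᴸ (map f (map (x ,_) ys)) + sumᴸ (map f (cartesianProduct xs ys))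
    ≡⟨ cong₂ _+_ (cong sumᴸ (sym (map-∘ ys))) (sum-map-cartesianProduct f xs ys) ⟩
  _ ∎
  where open ≡-Reasoning

sum-tabulate : ∀ {n} (f : Fin n → ℕ) → sumᴸ (tabulate f) ≡ sum f
sum-tabulate {zero}  f = refl
sum-tabulate {suc n} f = cong (f zero +_) (sum-tabulate (f ∘ suc))

sum-map-allFin : ∀ {n} (f : Fin n → ℕ) → sumᴸ (map f (allFin n)) ≡ sum f
sum-map-allFin f = trans (cong sumᴸ (map-tabulate (λ i → i) f)) (sum-tabulate f)

-- Masking by 0 keeps this a full double sum, so for `suc n` the first row and column split off by
-- computation.
upperSum : ∀ {n} → (Fin n → Fin n → ℕ) → ℕ
upperSum {n} f = ∑[ i < n ] ∑[ j < n ] (if does (i <? j) then f i j else 0)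

-- The first position fails `2 ≤ suc (toℕ l)`, so its row contributes only zeros. In the later rows
-- that bound holds, and column `zero` vanishes because `suc i < zero` is false.
reducedSum≡upperSum : ∀ {n} (f : Fin (suc n) → Fin (suc n) → ℕ) →
  reducedSum f ≡ upperSum (λ i j → f (suc i) (suc j))
reducedSum≡upperSum {n} f = begin
  reducedSum f
    ≡⟨ sum-map-filter (uncurry reduced?) (uncurry f) (cartesianProduct (allFin (suc n)) (allFin (suc n))) ⟩
  sumᴸ (map g (cartesianProduct (allFin (suc n)) (allFin (suc n))))
    ≡⟨ sum-map-cartesianProduct g (allFin (suc n)) (allFin (suc n)) ⟩
  sumᴸ (map (λ i → sumᴸ (map (λ j → g (i , j)) (allFin (suc n)))) (allFin (suc n)))
    ≡⟨ sum-map-allFin {suc n} _ ⟩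
  sum (λ i → sumᴸ (map (λ j → g (i , j)) (allFin (suc n))))
    ≡⟨ ∑.sum-cong-≗ (λ i → sum-map-allFin (λ j → g (i , j))) ⟩
  sum {suc n} (λ _ → 0) + upperSum (λ i j → f (suc i) (suc j))
    ≡⟨ cong (_+ upperSum (λ i j → f (suc i) (suc j))) (∑.sum-replicate-zero (suc n)) ⟩
  upperSum (λ i j → f (suc i) (suc j)) ∎
  where
  open ≡-Reasoning
  g : Fin (suc n) × Fin (suc n) → ℕ
  g (i , j) = if does (reduced? i j) then f i j else 0

-- Induction on the size of the matrix: by symmetry the first column repeats the first row off the
-- diagonal, which accounts for the factor 2.
sum-symmetric : ∀ {n} (f : Fin n → Fin n → ℕ) → (∀ i j → f i j ≡ f j i) →
  ∑[ i < n ] sum (f i) ≡ ∑[ i < n ] f i i + 2 * upperSum f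
sum-symmetric {zero}  f f-sym = refl
sum-symmetric {suc n} f f-sym = begin
  f zero zero + row + ∑[ i < n ] (f (suc i) zero + sum (g i))
    ≡⟨ cong (f zero zero + row +_) (∑.∑-distrib-+ (λ i → f (suc i) zero) (sum ∘ g)) ⟩
  f zero zero + row + (∑[ i < n ] f (suc i) zero + ∑[ i < n ] sum (g i))
    ≡⟨ cong (f zero zero + row +_) (cong₂ _+_ (∑.sum-cong-≗ λ i → f-sym (suc i) zero)
         (sum-symmetric g λ i j → f-sym (suc i) (suc j))) ⟩
  f zero zero + row + (row + (diag + 2 * upperSum g))
    ≡⟨ solve 4 (λ c r d u → c :+ r :+ (r :+ (d :+ con 2 :* u)) := c :+ d :+ con 2 :* (r :+ u))
         refl (f zero zero) row diag (upperSum g) ⟩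
  f zero zero + diag + 2 * (row + upperSum g) ∎
  where
  open ≡-Reasoning
  g : Fin n → Fin n → ℕ
  g i j = f (suc i) (suc j)
  row diag : ℕ
  row  = ∑[ j < n ] f zero (suc j)
  diag = ∑[ i < n ] g i i

sum-const : ∀ n {c} → ∑[ i < n ] c ≡ n * c
sum-const zero    = refl
sum-const (suc n) = cong (_ +_) (sum-const n)

-- Row sums of the intersection matrix and what they determine.

a-sym : ∀ {r n} (L : Family r n) i j → a L i j ≡ a L j i
a-sym L i j = cong ∣_∣ (∩-comm (L i) (L j))

module _ {s n k : ℕ} {L : Family (suc s) n} (rset : IsRSet L k) where
  open IsRSet rset

  a-diag : ∀ i → a L i i ≡ k + 1
  a-diag i = trans (cong ∣_∣ (∩-idem (L i))) (size i)

  -- Apply `redundant` to the complement of `⁅ i ⁆`, which has one element fewer than the index set: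
  -- the remaining sets still cover `x`.
  ∃-second : ∀ {i x} → x ∈ L i → ∃ λ j → i ≢ j × x ∈ L j
  ∃-second {i} {x} x∈Li with find (map⁻ (x∈⋃⁻ _ x∈rest))
    where
    x∈rest : x ∈ unionOver L (∁ ⁅ i ⁆)
    x∈rest = subst (x ∈_) (redundant (∁ ⁅ i ⁆)
        (cong suc (trans (∣∁p∣≡n∸∣p∣ ⁅ i ⁆) (cong (suc s ∸_) (∣⁅x⁆∣≡1 i)))))
      (x∈⋃⁺ (tabulate⁺ {f = L} i x∈Li))
  ... | j , j∈rest , x∈Lj = j , i≢j , x∈Lj
    where
    i≢j : i ≢ j
    i≢j refl = x∈∁p⇒x∉p (proj₂ (∈-filter⁻ (_∈? ∁ ⁅ i ⁆) {xs = allFin (suc s)} j∈rest)) (x∈⁅x⁆ i)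

  module _ (nonint : NonIntersectingType L) where

    -- The sum includes j = i, so a point of L i is counted twice.
    ∑-indicator-∩ : ∀ i x → ∑[ j < suc s ] indicator (L i ∩ L j) x ≡ 2 * indicator (L i) x
    ∑-indicator-∩ i x with x ∈? L i
    ... | no x∉Li = begin
      ∑[ j < suc s ] indicator (L i ∩ L j) x
        ≡⟨ ∑.sum-cong-≗ (λ j → indicator-∉ (x∉Li ∘ proj₁ ∘ x∈p∩q⁻ (L i) (L j))) ⟩
      ∑[ j < suc s ] 0        ≡⟨ ∑.sum-replicate-zero (suc s) ⟩
      0                       ≡⟨ cong (2 *_) (indicator-∉ x∉Li) ⟨
      2 * indicator (L i) x   ∎
      where open ≡-Reasoning
    ... | yes x∈Li with ∃-second x∈Li
    ...   | j , i≢j , x∈Lj = begin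
      ∑[ m < suc s ] indicator (L i ∩ L m) x
        ≡⟨ ∑.sum-cong-≗ split ⟩
      ∑[ m < suc s ] (indicator ⁅ i ⁆ m + indicator ⁅ j ⁆ m)
        ≡⟨ ∑.∑-distrib-+ (indicator ⁅ i ⁆) (indicator ⁅ j ⁆) ⟩
      sum (indicator ⁅ i ⁆) + sum (indicator ⁅ j ⁆)
        ≡⟨ cong₂ _+_ (sym (∣p∣≡∑indicator ⁅ i ⁆)) (sym (∣p∣≡∑indicator ⁅ j ⁆)) ⟩
      ∣ ⁅ i ⁆ ∣ + ∣ ⁅ j ⁆ ∣
        ≡⟨ cong₂ _+_ (∣⁅x⁆∣≡1 i) (∣⁅x⁆∣≡1 j) ⟩
      2
        ≡⟨ cong (2 *_) (indicator-∈ x∈Li) ⟨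
      2 * indicator (L i) x ∎
      where
      open ≡-Reasoning
      -- The point `x` lies in `L i ∩ L m` only for `m = i` and `m = j`; any other `m` would give a
      -- point common to three distinct sets. Summing over `m` thus counts two singletons.
      split : ∀ m → indicator (L i ∩ L m) x ≡ indicator ⁅ i ⁆ m + indicator ⁅ j ⁆ m
      split m with i ≟ m | j ≟ m
      ... | yes refl | yes refl = contradiction refl i≢j
      ... | yes refl | no j≢i = trans (indicator-∈ (x∈p∩q⁺ (x∈Li , x∈Li)))
        (sym (cong₂ _+_ (indicator-∈ (x∈⁅x⁆ i)) (indicator-∉ (x≢y⇒x∉⁅y⁆ (j≢i ∘ sym)))))
      ... | no _ | yes refl = trans (indicator-∈ (x∈p∩q⁺ (x∈Li , x∈Lj)))
        (sym (cong₂ _+_ (indicator-∉ (x≢y⇒x∉⁅y⁆ (i≢j ∘ sym))) (indicator-∈ (x∈⁅x⁆ j))))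
      ... | no i≢m | no j≢m = trans
        (indicator-∉ λ x∈Li∩Lm → nonint i j m i≢j i≢m j≢m
          (x , x∈p∩q⁺ (x∈Li , x∈p∩q⁺ (x∈Lj , proj₂ (x∈p∩q⁻ (L i) (L m) x∈Li∩Lm)))))
        (sym (cong₂ _+_ (indicator-∉ (x≢y⇒x∉⁅y⁆ (i≢m ∘ sym))) (indicator-∉ (x≢y⇒x∉⁅y⁆ (j≢m ∘ sym)))))

    -- Double counting of the pairs of an index `j` and a point of `L i ∩ L j`. The diagonal term
    -- `a L i i` is kept, so the total is twice `k + 1`.
    ∑-a : ∀ i → sum (a L i) ≡ 2 * (k + 1)
    ∑-a i = begin
      ∑[ j < suc s ] ∣ L i ∩ L j ∣
        ≡⟨ ∑.sum-cong-≗ (λ j → ∣p∣≡∑indicator (L i ∩ L j)) ⟩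
      ∑[ j < suc s ] ∑[ x < n ] indicator (L i ∩ L j) x
        ≡⟨ ∑.∑-comm (λ j → indicator (L i ∩ L j)) ⟩
      ∑[ x < n ] ∑[ j < suc s ] indicator (L i ∩ L j) x
        ≡⟨ ∑.sum-cong-≗ (∑-indicator-∩ i) ⟩
      ∑[ x < n ] (2 * indicator (L i) x)
        ≡⟨ *-distribˡ-sum 2 (indicator (L i)) ⟨
      2 * sum (indicator (L i))
        ≡⟨ cong (2 *_) (∣p∣≡∑indicator (L i)) ⟨
      2 * ∣ L i ∣
        ≡⟨ cong (2 *_) (size i) ⟩
      2 * (k + 1) ∎
      where open ≡-Reasoning

    -- Row `zero` without its diagonal entry, transposed into the column that appears when the other
    -- rows are summed.
    ∑-a-first : ∑[ i < s ] a L (suc i) zero ≡ k + 1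
    ∑-a-first = +-cancelˡ-≡ (k + 1) _ _ (begin
      k + 1 + ∑[ i < s ] a L (suc i) zero
        ≡⟨ cong₂ _+_ (a-diag zero) (∑.sum-cong-≗ λ i → a-sym L zero (suc i)) ⟨
      sum (a L zero)
        ≡⟨ ∑-a zero ⟩
      2 * (k + 1)
        ≡⟨ cong (k + 1 +_) (+-identityʳ (k + 1)) ⟩
      k + 1 + (k + 1) ∎)
      where open ≡-Reasoning

    reducedSum-a : s * (k + 1) ≡ k + 1 + 2 * reducedSum (a L)
    -- The extra `s * (k + 1)` is the sum of the diagonal entries `b i i`; with it on both sides the
    -- full rows of `∑-a` can be added without subtraction.
    reducedSum-a = +-cancelˡ-≡ (s * (k + 1)) _ _ (begin
      s * c + s * c
        ≡⟨ solve 2 (λ s c → s :* c :+ s :* c := s :* (con 2 :* c)) refl s c ⟩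
      s * (2 * c)
        ≡⟨ sum-const s ⟨
      ∑[ i < s ] (2 * c)
        ≡⟨ ∑.sum-cong-≗ (λ i → ∑-a (suc i)) ⟨
      ∑[ i < s ] (a L (suc i) zero + sum (b i))
        ≡⟨ ∑.∑-distrib-+ (λ i → a L (suc i) zero) (sum ∘ b) ⟩
      ∑[ i < s ] a L (suc i) zero + ∑[ i < s ] sum (b i)
        ≡⟨ cong₂ _+_ ∑-a-first (sum-symmetric b λ i j → a-sym L (suc i) (suc j)) ⟩
      c + (∑[ i < s ] b i i + 2 * upperSum b)
        ≡⟨ cong₂ (λ d u → c + (d + 2 * u))
             (trans (∑.sum-cong-≗ (λ i → a-diag (suc i))) (sum-const s))
             (sym (reducedSum≡upperSum (a L))) ⟩
      c + (s * c + 2 * reducedSum (a L))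
        ≡⟨ solve 3 (λ c d u → c :+ (d :+ con 2 :* u) := d :+ (c :+ con 2 :* u))
             refl c (s * c) (reducedSum (a L)) ⟩
      s * c + (c + 2 * reducedSum (a L)) ∎)
      where
      open ≡-Reasoning
      c : ℕ
      c = k + 1
      b : Fin s → Fin s → ℕ
      b i j = a L (suc i) (suc j)

-- Only the pairs `zero`, `suc t` need an argument. Row `suc t` has the same total in both families
-- and the same entries outside column `zero`, so cancellation leaves equal entries in that column.
reduced-determines : ∀ {s n k} {L M : Family (suc s) n} →
  IsRSet L k → NonIntersectingType L → IsRSet M k → NonIntersectingType M →
  (∀ l t → Reduced l t → a L l t ≡ a M l t) → ∀ i j → i < j → a L i j ≡ a M i j
reduced-determines rL nL rM nM eq (suc i) j i<j = eq (suc i) j (s≤s (s≤s z≤n) , i<j)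
reduced-determines {s} {L = L} {M} rL nL rM nM eq zero (suc t) _ = begin
  a L zero (suc t)  ≡⟨ a-sym L zero (suc t) ⟩
  a L (suc t) zero  ≡⟨ +-cancelʳ-≡ (∑[ j < s ] a M (suc t) (suc j)) _ _ rows ⟩
  a M (suc t) zero  ≡⟨ a-sym M (suc t) zero ⟩
  a M zero (suc t)  ∎
  where
  open ≡-Reasoning
  -- Above the diagonal this is the hypothesis, on it both entries are `k + 1`, and below it
  -- symmetry swaps the indices.
  entry : ∀ j → a L (suc t) (suc j) ≡ a M (suc t) (suc j)
  entry j with <-cmp (suc t) (suc j)
  ... | tri< t<j _ _ = eq (suc t) (suc j) (s≤s (s≤s z≤n) , t<j)
  ... | tri≈ _ refl _ = trans (a-diag rL (suc t)) (sym (a-diag rM (suc t)))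
  ... | tri> _ _ j<t = begin
    a L (suc t) (suc j)  ≡⟨ a-sym L (suc t) (suc j) ⟩
    a L (suc j) (suc t)  ≡⟨ eq (suc j) (suc t) (s≤s (s≤s z≤n) , j<t) ⟩
    a M (suc j) (suc t)  ≡⟨ a-sym M (suc j) (suc t) ⟩
    a M (suc t) (suc j)  ∎
  rows : a L (suc t) zero + ∑[ j < s ] a M (suc t) (suc j) ≡ a M (suc t) zero + ∑[ j < s ] a M (suc t) (suc j)
  rows = begin
    a L (suc t) zero + ∑[ j < s ] a M (suc t) (suc j)
      ≡⟨ cong (a L (suc t) zero +_) (∑.sum-cong-≗ entry) ⟨
    sum (a L (suc t))  ≡⟨ ∑-a rL nL (suc t) ⟩
    _                  ≡⟨ ∑-a rM nM (suc t) ⟨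
    sum (a M (suc t))  ∎

proposition4p2 : ∀ (n r k : ℕ) → 4 ≤ r → r ∸ 2 ≤ k →
    (L : Family r n) → IsRSet L k → NonIntersectingType L →
    2 * ∣ union L ∣ ≡ r * (k + 1) →
    (∀ (M : Family r n) → IsRSet M k → NonIntersectingType M →
    2 * ∣ union M ∣ ≡ r * (k + 1) →
    (∀ (i j : Fin r) → i < j → a L i j ≡ a M i j)
    ⇔ (∀ (l t : Fin r) → Reduced l t → a L l t ≡ a M l t))
    × (∀ (l t : Fin r) → Reduced l t → 1 ≤ a L l t)
    × (r ∸ 2) * (k + 1) ≡ 2 * reducedSum (a L)
proposition4p2 n (suc zero) k (s≤s ())
proposition4p2 n (suc (suc r)) k _ _ L rL nL _ =
    (λ M rM nM _ → mk⇔ (λ eq l t (_ , l<t) → eq l t l<t) (reduced-determines rL nL rM nM))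
  , (λ l t (_ , l<t) → nonempty⇒1≤∣p∣ (IsRSet.intersecting rL l t l<t))
  -- With `s = suc r` the left side of `reducedSum-a` unfolds to `k + 1 + r * (k + 1)`, so one copy
  -- of `k + 1` cancels.
  , +-cancelˡ-≡ (k + 1) _ _ (reducedSum-a rL nL)
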